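{- Let $T^\sigma=(T,\sigma)$ be a signed tree whose underlying tree $T$ is not a path, and suppose that $\operatorname{ter}(t)\neq 2$ for every special exterior major vertex $t$ of $T^\sigma$. Then $\dim(T^\sigma)=\dim(T)-|\eta(T^\sigma)|$, where $\eta(T^\sigma)$ is the set of special exterior major vertices of $T^\sigma$.
   Context: A signed tree is $(T,\sigma)$ with $\sigma:E(T)\to\{+1,-1\}$; the sign $\sigma(uv)$ of the unique $u$–$v$ path is the product of its edge signs, and the signed distance is $d_\Sigma(u,v)=\sigma(uv)d(u,v)$, $d$ the distance in $T$. For an ordered vertex set $W=(w_1,\dots,w_k)$, $r(v|W)=(d_\Sigma(v,w_1),\dots,d_\Sigma(v,w_k))$; $W$ is resolving if distinct vertices have distinct representations; $\dim(T^\sigma)$ is the minimum cardinality of a resolving set, and $\dim(T)$ is the usual metric dimension of $T$ (using $d$). A leaf is a vertex of degree $1$; a major vertex is a vertex of degree at least $3$. A leaf $u$ is a terminal vertex of a major vertex $v$ if $d(u,v)<d(u,w)$ for every other major vertex $w$. The terminal degree $\operatorname{ter}(v)$ is the number of terminal vertices of $v$. An exterior major vertex is a major vertex with positive terminal degree. A leg of an exterior major vertex $t$ is the path from $t$ to one of its terminal vertices. For an exterior major vertex $t$, a vertex $u$ on a leg of $t$ has index $i$ if $d(t,u)=i$. An exterior major vertex $t$ is special if there are two distinct legs $L,L'$ of $t$ such that $d_\Sigma(t,u)\neq d_\Sigma(t,v)$ whenever $u\in L$ and $v\in L'$ have the same index $i\ge 1$. -}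

module Defs where

open import Data.Nat using (ℕ; zero; suc; _≤_; _<_; _∸_)
open import Data.Integer using (ℤ; _◃_)
open import Data.Sign using (Sign) renaming (_*_ to _*ˢ_)
open import Data.Bool using (Bool; true; false)
open import Data.Fin using (Fin)
open import Data.List using (List; []; _∷_; length; map; filterᵇ; _++_; allFin)
open import Data.List.Membership.Propositional using (_∈_)
open import Data.List.Relation.Unary.Unique.Propositional using (Unique)
open import Data.Product using (Σ; _×_; _,_; proj₁; ∃; ∃₂)
open import Data.Sum using (_⊎_)
open import Relation.Binary.PropositionalEquality using (_≡_; _≢_)
open import Function.Bundles using (_⇔_)

data Walk {n : ℕ} (E : Fin n → Fin n → Bool) : Fin n → Fin n → Set where
  stop : (u : Fin n) → Walk E u u
  step : (u v : Fin n) {w : Fin n} → E u v ≡ true → Walk E v w → Walk E u w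

module _ {n : ℕ} {E : Fin n → Fin n → Bool} where

  verts : {u v : Fin n} → Walk E u v → List (Fin n)
  verts (stop u) = u ∷ []
  verts (step u _ _ p) = u ∷ verts p

  wlen : {u v : Fin n} → Walk E u v → ℕ
  wlen (stop u) = 0
  wlen (step _ _ _ p) = suc (wlen p)

  wsign : (Fin n → Fin n → Sign) → {u v : Fin n} → Walk E u v → Sign
  wsign σ (stop u) = Sign.+
  wsign σ (step u v _ p) = σ u v *ˢ wsign σ p

  Path : Fin n → Fin n → Set
  Path u v = Σ (Walk E u v) (λ p → Unique (verts p))

record Tree (n : ℕ) : Set where
  field
    E       : Fin n → Fin n → Bool
    E-sym   : ∀ u v → E u v ≡ E v u
    E-irr   : ∀ u → E u u ≡ false
    path    : (u v : Fin n) → Path {E = E} u v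
    path-unique : (u v : Fin n) (p : Path {E = E} u v) → verts (proj₁ p) ≡ verts (proj₁ (path u v))

-- A signature of the edges of T (values on non-edges are irrelevant).
record Signing {n : ℕ} (T : Tree n) : Set where
  field
    σ     : Fin n → Fin n → Sign
    σ-sym : ∀ u v → σ u v ≡ σ v u

module _ {n : ℕ} (T : Tree n) where
  open Tree T

  dist : Fin n → Fin n → ℕ
  dist u v = wlen (proj₁ (path u v))

  pathVerts : Fin n → Fin n → List (Fin n)
  pathVerts u v = verts (proj₁ (path u v))

  deg : Fin n → ℕ
  deg v = length (filterᵇ (E v) (allFin n))

  Leaf : Fin n → Set
  Leaf v = deg v ≡ 1

  Major : Fin n → Set
  Major v = 3 ≤ deg v

  Terminal : Fin n → Fin n → Set
  Terminal u v = Leaf u × Major v × (∀ w → Major w → w ≢ v → dist u v < dist u w)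

  TerDeg : Fin n → ℕ → Set
  TerDeg v k = Σ (List (Fin n)) λ L → Unique L × (∀ u → (u ∈ L ⇔ Terminal u v)) × length L ≡ k

  ExteriorMajor : Fin n → Set
  ExteriorMajor v = Major v × ∃ λ u → Terminal u v

  Consecutive : List (Fin n) → Fin n → Fin n → Set
  Consecutive xs u w = ∃₂ λ as bs → (xs ≡ as ++ u ∷ w ∷ bs) ⊎ (xs ≡ as ++ w ∷ u ∷ bs)

  IsPathGraph : Set
  IsPathGraph = Σ (List (Fin n)) λ xs → Unique xs × (∀ v → v ∈ xs) ×
                  (∀ u w → (E u w ≡ true ⇔ Consecutive xs u w))

  Resolving : List (Fin n) → Set
  Resolving W = ∀ u v → map (dist u) W ≡ map (dist v) W → u ≡ v

  IsMetricDim : ℕ → Set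
  IsMetricDim k = (Σ (List (Fin n)) λ W → Resolving W × length W ≡ k) ×
                  (∀ W → Resolving W → k ≤ length W)

module _ {n : ℕ} {T : Tree n} (S : Signing T) where
  open Tree T
  open Signing S

  sdist : Fin n → Fin n → ℤ
  sdist u v = wsign σ (proj₁ (path u v)) ◃ dist T u v

  -- special exterior major vertex: two distinct legs (paths to distinct terminal vertices)
  -- such that vertices of equal index i ≥ 1 have distinct signed distances to t
  Special : Fin n → Set
  Special t = ExteriorMajor T t × ∃₂ λ u u' → Terminal T u t × Terminal T u' t × u ≢ u' ×
              (∀ x y → x ∈ pathVerts T t u → y ∈ pathVerts T t u' →
                 dist T t x ≡ dist T t y → 1 ≤ dist T t x → sdist t x ≢ sdist t y)

  SResolving : List (Fin n) → Set
  SResolving W = ∀ u v → map (sdist u) W ≡ map (sdist v) W → u ≡ v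

  IsSignedMetricDim : ℕ → Set
  IsSignedMetricDim k = (Σ (List (Fin n)) λ W → SResolving W × length W ≡ k) ×
                        (∀ W → SResolving W → k ≤ length W)

{-# OPTIONS --safe #-}
module Submission where

-- For a list W, both metric dimensions are controlled by which legs W meets. If W resolves,
-- two terminal vertices of t whose legs avoid W must carry opposite signs at every common
-- index, and among three legs two agree at index 1; so W misses at most one leg of each
-- exterior major vertex, or at most two if it is special. Conversely, take all terminal
-- vertices except one per exterior major vertex, or except a witnessing pair if it is special.
-- If x and y were not separated, they would meet the paths to W at a common major vertex m
-- whose branches towards x and y avoid W, hence are two missing legs of m, and those are
-- opposite. Counting gives dim + #special + #exterior majors = #terminal vertices, for the
-- given signing as well as for the all-positive one, where nothing is special.

open import Defs
open import Data.Bool using (Bool; true; T?)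
open import Data.Bool.Properties using (T-≡)
open import Data.Empty using (⊥)
open import Data.Fin using (Fin)
import Data.Fin as Fin
open import Data.Fin.Properties as Finₚ using (_≟_; any?; all?)
open import Data.Integer using (_◃_; ∣_∣)
open import Data.Integer.Properties using (abs-◃; sign-cong)
open import Data.List using (List; []; _∷_; length; map; filter; filterᵇ; _++_; allFin)
open import Data.List.Extrema.Nat using (argmax; argmax-all; f[xs]≤f[argmax])
open import Data.List.Membership.DecPropositional using (_∈?_)
open import Data.List.Membership.Propositional using (_∈_; _∉_; find; lose)
open import Data.List.Membership.Propositional.Properties using (∈-++⁺ʳ; ∈-++⁺ˡ; ∈-++⁻; ∈-filter⁺; ∈-filter⁻; ∈-allFin; ∈-∃++)
open import Data.List.Properties using (∷-injectiveˡ; ∷-injectiveʳ; length-++; map-cong-local)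
import Data.List.Relation.Unary.All as All
open import Data.List.Relation.Unary.All using ([]; _∷_)
open import Data.List.Relation.Unary.All.Properties using (¬Any⇒All¬; All¬⇒¬Any)
open import Data.List.Relation.Unary.AllPairs using ([]; _∷_)
open import Data.List.Relation.Unary.Any as Any using (Any; here; there)
open import Data.List.Relation.Unary.Unique.Propositional using (Unique)
open import Data.List.Relation.Unary.Unique.Propositional.Properties using (filter⁺; allFin⁺)
open import Data.Nat using (ℕ; zero; suc; _+_; _≤_; _<_; z≤n; s≤s; >-nonZero)
open import Data.Nat.Properties as ℕₚ using (≤-refl; ≤-trans; ≤-reflexive; ≤-antisym; +-comm; +-assoc; suc-injective)
open import Data.Product using (Σ; _×_; _,_; proj₁; proj₂; ∃; ∃₂; ∃-syntax)
open import Data.Sign using (Sign) renaming (_*_ to _*ˢ_)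
import Data.Sign.Properties as Sₚ
open import Data.Sum using (_⊎_; inj₁; inj₂; [_,_]′)
open import Data.Unit using (⊤; tt)
open import Function using (_∘_; case_of_)
open import Function.Bundles using (_⇔_; Equivalence; mk⇔)
open import Relation.Binary using (tri<; tri≈; tri>)
open import Relation.Binary.PropositionalEquality using (_≡_; _≢_; refl; sym; trans; cong; cong₂; subst; subst₂; ≢-sym; module ≡-Reasoning)
open import Relation.Nullary using (¬_; Dec; yes; no; contradiction)
open import Relation.Nullary.Decidable using (_×-dec_; _→-dec_; ¬?; decidable-stable)
open import Relation.Unary using (Decidable)

-- Extremal vertices, and walks read as vertex lists.

abstract
  maximiser : {n : ℕ} {P : Fin n → Set} → Decidable P → (f : Fin n → ℕ) → ∃ P →
              ∃[ x ] P x × (∀ y → P y → f y ≤ f x)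
  maximiser {n} {P} P? f (x₀ , px₀) =
    argmax f x₀ xs
    , argmax-all f px₀ (All.tabulate (λ z∈ → proj₂ (∈-filter⁻ P? {xs = allFin n} z∈)))
    , λ y py → All.lookup (f[xs]≤f[argmax] x₀ xs) (∈-filter⁺ P? (∈-allFin y) py)
    where
    xs : List (Fin n)
    xs = filter P? (allFin n)

module _ {n : ℕ} {E : Fin n → Fin n → Bool} where

  start∈verts : {u w : Fin n} (p : Walk E u w) → u ∈ verts p
  start∈verts (stop _)       = here refl
  start∈verts (step _ _ _ _) = here refl

  length-verts : {u w : Fin n} (p : Walk E u w) → length (verts p) ≡ suc (wlen p)
  length-verts (stop _)       = refl
  length-verts (step _ _ _ p) = cong suc (length-verts p)

  same-start : {u u' w w' : Fin n} (p : Walk E u w) (q : Walk E u' w') → verts p ≡ verts q → u ≡ u'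
  same-start (stop _)       (stop _)       eq = ∷-injectiveˡ eq
  same-start (stop _)       (step _ _ _ _) eq = ∷-injectiveˡ eq
  same-start (step _ _ _ _) (stop _)       eq = ∷-injectiveˡ eq
  same-start (step _ _ _ _) (step _ _ _ _) eq = ∷-injectiveˡ eq

  -- The sign of a walk depends on its vertices alone, so `path-unique`, which compares only vertex
  -- lists, also fixes signs.
  wsign-cong : (σ : Fin n → Fin n → Sign) {u u' w w' : Fin n} (p : Walk E u w) (q : Walk E u' w') →
               verts p ≡ verts q → wsign σ p ≡ wsign σ q
  wsign-cong σ (stop _) (stop _) eq = refl
  wsign-cong σ (stop _) (step _ _ _ (stop _)) ()
  wsign-cong σ (stop _) (step _ _ _ (step _ _ _ _)) ()
  wsign-cong σ (step _ _ _ (stop _)) (stop _) ()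
  wsign-cong σ (step _ _ _ (step _ _ _ _)) (stop _) ()
  wsign-cong σ (step u v _ p) (step u' v' _ q) eq =
    cong₂ _*ˢ_ (cong₂ σ (∷-injectiveˡ eq) (same-start p q (∷-injectiveʳ eq))) (wsign-cong σ p q (∷-injectiveʳ eq))

  suffix : {u w x : Fin n} (p : Walk E u w) → Unique (verts p) → x ∈ verts p →
           Σ (Walk E x w) λ q → Unique (verts q) × ∃[ as ] verts p ≡ as ++ verts q
  suffix (stop u)       U        (here refl) = stop u , U , [] , refl
  suffix (step u v e p) U        (here refl) = step u v e p , U , [] , refl
  suffix (step u v e p) (_ ∷ U)  (there x∈)  with suffix p U x∈
  ... | q , Uq , as , eq = q , Uq , u ∷ as , cong (u ∷_) eq

  verts-consecutive : {u w : Fin n} (p : Walk E u w) (as : List (Fin n)) {bs : List (Fin n)} {x y : Fin n} →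
                      verts p ≡ as ++ x ∷ y ∷ bs → E x y ≡ true
  verts-consecutive (stop _) [] ()
  verts-consecutive (stop _) (_ ∷ []) ()
  verts-consecutive (stop _) (_ ∷ _ ∷ _) ()
  verts-consecutive (step u v e (stop _)) [] refl = e
  verts-consecutive (step u v e (step _ _ _ _)) [] refl = e
  verts-consecutive (step u v e p) (_ ∷ as) eq = verts-consecutive p as (∷-injectiveʳ eq)

-- Distance and betweenness in a tree.

module TreeMetric {n : ℕ} (T : Tree n) where
  open Tree T

  d : Fin n → Fin n → ℕ
  d = dist T

  verts-tail : {u v w : Fin n} → E u v ≡ true → u ∉ pathVerts T v w → pathVerts T u w ≡ u ∷ pathVerts T v w
  verts-tail {u} {v} {w} e u∉ with path v w
  ... | p , Up = sym (path-unique u w (step u v e p , ¬Any⇒All¬ _ u∉ ∷ Up))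

  -- If `u` lies on the path from `v`, then the path from `u` is a proper suffix of it and cannot
  -- contain `v`; so one of the two paths always extends the other by the edge.
  edge-verts : {u v : Fin n} → E u v ≡ true → (w : Fin n) →
               pathVerts T u w ≡ u ∷ pathVerts T v w ⊎ pathVerts T v w ≡ v ∷ pathVerts T u w
  edge-verts {u} {v} e w with _∈?_ _≟_ u (pathVerts T v w)
  ... | no u∉ = inj₁ (verts-tail e u∉)
  ... | yes u∈ = inj₂ (verts-tail (trans (E-sym v u) e) (v∉ (proj₁ (path v w)) (proj₂ (path v w)) u∈))
    where
    v≢u : v ≢ u
    v≢u refl = case trans (sym e) (E-irr u) of λ ()
    v∉ : (p : Walk E v w) → Unique (verts p) → u ∈ verts p → v ∉ pathVerts T u w
    v∉ (stop _)       _         (here u≡v)  _  = v≢u (sym u≡v)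
    v∉ (step _ _ _ p) _         (here u≡v)  _  = v≢u (sym u≡v)
    v∉ (step _ _ _ p) (v∉p ∷ U) (there u∈p) v∈ with suffix p U u∈p
    ... | q , Uq , as , eq = All¬⇒¬Any v∉p
      (subst (v ∈_) (sym eq) (∈-++⁺ʳ as (subst (v ∈_) (sym (path-unique u w (q , Uq))) v∈)))

  -- Encodes the first step `v` of the path from `u` to `w`. The distance form allows arithmetic,
  -- and `next⇒verts` recovers the vertex list.
  Next : Fin n → Fin n → Fin n → Set
  Next u v w = E u v ≡ true × d u w ≡ suc (d v w)

  length-pathVerts : ∀ u w → length (pathVerts T u w) ≡ suc (d u w)
  length-pathVerts u w = length-verts (proj₁ (path u w))

  verts⇒next : ∀ {u v w} → E u v ≡ true → pathVerts T u w ≡ u ∷ pathVerts T v w → Next u v w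
  verts⇒next {u} {v} {w} e eq = e , suc-injective (trans (sym (length-pathVerts u w))
    (trans (cong length eq) (cong suc (length-pathVerts v w))))

  -- Bipartiteness of a tree: no edge joins two vertices at equal distance from `w`.
  edge-next : ∀ {u v} → E u v ≡ true → ∀ w → Next u v w ⊎ Next v u w
  edge-next {u} {v} e w with edge-verts e w
  ... | inj₁ eq = inj₁ (verts⇒next e eq)
  ... | inj₂ eq = inj₂ (verts⇒next (trans (E-sym v u) e) eq)

  next-asym : ∀ {u v w} → Next u v w → ¬ Next v u w
  next-asym (_ , p) (_ , q) = ℕₚ.m≢1+m+n _ {1} (trans p (cong suc (trans q (+-comm 1 _))))

  next⇒verts : ∀ {u v w} → Next u v w → pathVerts T u w ≡ u ∷ pathVerts T v w
  next⇒verts {u} {v} {w} nx@(e , _) with edge-verts e w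
  ... | inj₁ eq = eq
  ... | inj₂ eq = contradiction (verts⇒next (trans (E-sym v u) e) eq) (next-asym nx)

  d-refl : ∀ u → d u u ≡ 0
  d-refl u = sym (suc-injective (trans (cong length (path-unique u u (stop u , [] ∷ []))) (length-pathVerts u u)))

  abstract
    next-exists : ∀ {u w} → u ≢ w → ∃[ v ] Next u v w
    next-exists {u} {w} u≢w = go (proj₁ (path u w)) (proj₂ (path u w)) refl
      where
      go : (p : Walk E u w) → Unique (verts p) → verts p ≡ pathVerts T u w → ∃[ v ] Next u v w
      go (stop _) _ _ = contradiction refl u≢w
      go (step _ v e p) (_ ∷ U) eq = v , verts⇒next e (trans (sym eq) (cong (u ∷_) (path-unique v w (p , U))))

  next-unique : ∀ {u v v' w} → Next u v w → Next u v' w → v ≡ v'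
  next-unique {w = w} a b = same-start (proj₁ (path _ w)) (proj₁ (path _ w))
    (∷-injectiveʳ (trans (sym (next⇒verts a)) (next⇒verts b)))

  d≡0⇒≡ : ∀ {u w} → d u w ≡ 0 → u ≡ w
  d≡0⇒≡ {u} {w} d0 with u ≟ w
  ... | yes eq = eq
  ... | no u≢w with next-exists u≢w
  ... | _ , _ , eq = case trans (sym d0) eq of λ ()

  -- Induction from parent to child in the tree rooted at `w`; it takes the place of recursion on
  -- walks.
  toward-induction : (w : Fin n) (P : Fin n → Set) → P w → (∀ {u v} → Next u v w → P v → P u) → ∀ u → P u
  toward-induction w P base ind u = go (d u w) refl
    where
    go : ∀ {u} k → d u w ≡ k → P u
    go {u} k eq with u ≟ w
    ... | yes refl = base
    ... | no u≢w with next-exists u≢w | k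
    ... | v , nx | zero  = case trans (sym eq) (proj₂ nx) of λ ()
    ... | v , nx | suc j = ind nx (go j (suc-injective (trans (sym (proj₂ nx)) eq)))

  edge-≤ : ∀ {u v} → E u v ≡ true → ∀ w → d u w ≤ suc (d v w)
  edge-≤ e w with edge-next e w
  ... | inj₁ (_ , eq) = ≤-reflexive eq
  ... | inj₂ (_ , eq) = ≤-trans (ℕₚ.n≤1+n _) (≤-trans (≤-reflexive (sym eq)) (ℕₚ.n≤1+n _))

  E-flip : ∀ {u v} → E u v ≡ true → E v u ≡ true
  E-flip {u} {v} e = trans (E-sym v u) e

  triangle : ∀ x y z → d x z ≤ d x y + d y z
  triangle x y z = toward-induction y (λ x → d x z ≤ d x y + d y z)
    (ℕₚ.m≤n+m (d y z) (d y y))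
    (λ {u} {v} (e , eq) ih → ≤-trans (edge-≤ e z) (subst (λ t → suc (d v z) ≤ t + d y z) (sym eq) (s≤s ih)))
    x

  -- No walk is reversed: `spread` is the triangle inequality with its first distance read
  -- backwards, and its case `z = x` gives half of the symmetry.
  d-sym : ∀ x y → d x y ≡ d y x
  d-sym x y = ≤-antisym (half y x) (half x y)
    where
    spread : ∀ x y z → d y z ≤ d x y + d x z
    spread x y z = toward-induction y (λ x → d y z ≤ d x y + d x z)
      (ℕₚ.m≤n+m (d y z) (d y y))
      (λ {u} {v} (e , eq) ih → ≤-trans ih (subst (d v y + d v z ≤_) (cong (_+ d u z) (sym eq))
        (≤-trans (ℕₚ.+-monoʳ-≤ (d v y) (edge-≤ (E-flip e) z)) (≤-reflexive (ℕₚ.+-suc (d v y) (d u z))))))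
      x
    half : ∀ x y → d y x ≤ d x y
    half x y = ≤-trans (spread x y x) (≤-reflexive (trans (cong (d x y +_) (d-refl x)) (ℕₚ.+-identityʳ _)))

  -- The equality case of the triangle inequality. It is equivalent to membership in `pathVerts` and
  -- reduces path arguments to arithmetic.
  Btw : Fin n → Fin n → Fin n → Set
  Btw a b c = d a b + d b c ≡ d a c

  btw? : ∀ a b c → Dec (Btw a b c)
  btw? a b c = (d a b + d b c) ℕₚ.≟ d a c

  btw-sym : ∀ {a b c} → Btw a b c → Btw c b a
  btw-sym {a} {b} {c} h = trans (cong₂ _+_ (d-sym c b) (d-sym b a)) (trans (+-comm (d b c) (d a b)) (trans h (d-sym a c)))

  btw-left : ∀ a b → Btw a a b
  btw-left a b = cong (_+ d a b) (d-refl a)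

  btw-right : ∀ a b → Btw a b b
  btw-right a b = trans (cong (d a b +_) (d-refl b)) (ℕₚ.+-identityʳ _)

  btw-≤ : ∀ {a b c} → d a b + d b c ≤ d a c → Btw a b c
  btw-≤ {a} {b} {c} h = ≤-antisym h (triangle a b c)

  btw-inner : ∀ {a b c e} → Btw a b c → Btw a c e → Btw b c e
  btw-inner {a} {b} {c} {e} h k = btw-≤ (ℕₚ.+-cancelˡ-≤ (d a b) _ _ (begin
      d a b + (d b c + d c e) ≡⟨ sym (+-assoc (d a b) _ _) ⟩
      (d a b + d b c) + d c e ≡⟨ cong (_+ d c e) h ⟩
      d a c + d c e           ≡⟨ k ⟩
      d a e                   ≤⟨ triangle a b e ⟩
      d a b + d b e           ∎))
    where open ℕₚ.≤-Reasoning

  btw-outer : ∀ {a b c e} → Btw a b c → Btw a c e → Btw a b e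
  btw-outer {a} {b} {c} {e} h k = begin
      d a b + d b e           ≡⟨ cong (d a b +_) (sym (btw-inner h k)) ⟩
      d a b + (d b c + d c e) ≡⟨ sym (+-assoc (d a b) _ _) ⟩
      (d a b + d b c) + d c e ≡⟨ cong (_+ d c e) h ⟩
      d a c + d c e           ≡⟨ k ⟩
      d a e                   ∎
    where open ≡-Reasoning

  btw-antisym : ∀ {a b c} → Btw a b c → Btw a c b → b ≡ c
  btw-antisym {a} {b} {c} h k = d≡0⇒≡ (ℕₚ.m+n≡0⇒m≡0 (d b c) (ℕₚ.+-cancelˡ-≡ (d a b) _ _ (begin
      d a b + (d b c + d c b) ≡⟨ sym (+-assoc (d a b) _ _) ⟩
      (d a b + d b c) + d c b ≡⟨ cong (_+ d c b) h ⟩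
      d a c + d c b           ≡⟨ k ⟩
      d a b                   ≡⟨ sym (ℕₚ.+-identityʳ _) ⟩
      d a b + 0               ∎)))
    where open ≡-Reasoning

  d>0 : ∀ {a b} → a ≢ b → 1 ≤ d a b
  d>0 {a} {b} a≢b with d a b in eq
  ... | zero  = contradiction (d≡0⇒≡ eq) a≢b
  ... | suc _ = s≤s z≤n

  btw-< : ∀ {a b c} → Btw a b c → b ≢ c → d a b < d a c
  btw-< {a} {b} {c} h b≢c = subst (d a b <_) h (ℕₚ.m<m+n (d a b) (d>0 b≢c))

  edge-d : ∀ {u v} → E u v ≡ true → d u v ≡ 1
  edge-d {u} {v} e with edge-next e v
  ... | inj₁ (_ , eq) = trans eq (cong suc (d-refl v))
  ... | inj₂ (_ , eq) = case trans (sym (d-refl v)) eq of λ ()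

  next⇒btw : ∀ {u v w} → Next u v w → Btw u v w
  next⇒btw {u} {v} {w} (e , eq) = trans (cong (_+ d v w) (edge-d e)) (sym eq)

  btw⇒next : ∀ {u v w} → E u v ≡ true → Btw u v w → Next u v w
  btw⇒next {u} {v} {w} e h = e , trans (sym h) (cong (_+ d v w) (edge-d e))

  next-extend : ∀ {u v x w} → Next u v x → Btw u x w → Next u v w
  next-extend nx h = btw⇒next (proj₁ nx) (btw-outer (next⇒btw nx) h)

  edge-≢ : ∀ {u v} → E u v ≡ true → u ≢ v
  edge-≢ {u} e refl = case trans (sym e) (E-irr u) of λ ()

  -- In a tree a path that starts by moving away from c keeps moving away, because the
  -- neighbour closer to c is unique and already behind it.
  away : ∀ {v v' b c} → Next v v' b → Next v' v c → Btw b v c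
  away {v} {v'} {b} {c} nb nc =
      trans (cong (_+ d v c) (d-sym b v)) (toward-induction b P base ind' v' v nb nc)
    where
    P : Fin n → Set
    P v' = ∀ v → Next v v' b → Next v' v c → d v b + d v c ≡ d b c
    base : P b
    base v (_ , eq) (_ , eq') = trans (cong (_+ d v c) (trans eq (cong suc (d-refl b)))) (sym eq')
    ind' : ∀ {u w} → Next u w b → P w → P u
    ind' {u} {w} nw ih v (_ , eq) nc with edge-next (proj₁ nw) c
    ... | inj₁ closer with next-unique closer nc
    ... | refl = contradiction (trans eq (cong suc (proj₂ nw))) (λ r → ℕₚ.m≢1+m+n (d v b) {1} (trans r (cong suc (+-comm 1 _))))
    ind' {u} {w} nw ih v (_ , eq) nc | inj₂ further =
      trans (cong (_+ d v c) eq) (trans (sym (ℕₚ.+-suc (d u b) (d v c)))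
        (trans (cong (d u b +_) (sym (proj₂ nc))) (ih u nw further)))

  -- The edge to `a` cannot also lead towards `q`, since the first step towards `q` is unique; so it
  -- leads away from `q`, and `away` applies.
  away′ : ∀ {m a b p q} → Next m a p → Next m b q → a ≢ b → Btw p m q
  away′ {m} {a} {b} {p} {q} na nb a≢b with edge-next (proj₁ na) q
  ... | inj₁ na' = contradiction (next-unique na' nb) a≢b
  ... | inj₂ far = away na far

  -- With a common first step, the detour to `m` could be skipped, which would shorten the path from
  -- `p` to `q` by two.
  branches-≢ : ∀ {m a b p q} → Next m a p → Next m b q → Btw p m q → a ≢ b
  branches-≢ {m} {a} {b} {p} {q} na nb h refl = ℕₚ.<-irrefl refl (begin-strict
      d p q             ≤⟨ triangle p a q ⟩
      d p a + d a q     ≡⟨ cong (_+ d a q) (d-sym p a) ⟩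
      d a p + d a q     <⟨ ℕₚ.+-mono-< ≤-refl ≤-refl ⟩
      suc (d a p) + suc (d a q) ≡⟨ cong₂ _+_ (trans (sym (proj₂ na)) (d-sym m p)) (sym (proj₂ nb)) ⟩
      d p m + d m q     ≡⟨ h ⟩
      d p q             ∎)
    where open ℕₚ.≤-Reasoning

  abstract
    -- Move `a` away from `b` one edge at a time. If the edge also leads towards `c`, the old median
    -- still serves; otherwise the new vertex lies between `b` and `c` and is itself the median.
    median : ∀ a b c → ∃[ m ] Btw a m b × Btw b m c × Btw a m c
    median a b c = toward-induction b (λ a → ∃[ m ] Btw a m b × Btw b m c × Btw a m c)
        (b , btw-left b b , btw-left b c , btw-left b c) ind' a
      where
      ind' : ∀ {u v} → Next u v b → (∃[ m ] Btw v m b × Btw b m c × Btw v m c) → ∃[ m ] Btw u m b × Btw b m c × Btw u m c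
      ind' {u} {v} nx (m , h₁ , h₂ , h₃) with edge-next (proj₁ nx) c
      ... | inj₁ nx' = m , lift nx h₁ , h₂ , lift nx' h₃
        where
        lift : ∀ {w} → Next u v w → Btw v m w → Btw u m w
        lift {w} nx h = btw-sym (btw-outer (btw-sym h) (btw-sym (next⇒btw nx)))
      ... | inj₂ far = u , btw-left u b , away nx far , btw-left u c

  ∈pathVerts⇒btw : ∀ {u x w} → x ∈ pathVerts T u w → Btw u x w
  ∈pathVerts⇒btw {u} {x} {w} = toward-induction w (λ u → x ∈ pathVerts T u w → Btw u x w) base ind' u
    where
    base : x ∈ pathVerts T w w → Btw w x w
    base x∈ with subst (x ∈_) (sym (path-unique w w (stop w , [] ∷ []))) x∈
    ... | here refl = btw-left w w
    ind' : ∀ {u v} → Next u v w → (x ∈ pathVerts T v w → Btw v x w) → x ∈ pathVerts T u w → Btw u x w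
    ind' {u} {v} nx ih x∈ with subst (x ∈_) (next⇒verts nx) x∈
    ... | here refl = btw-left u w
    ... | there x∈' = btw-sym (btw-outer (btw-sym (ih x∈')) (btw-sym (next⇒btw nx)))

  btw⇒∈pathVerts : ∀ {u x w} → Btw u x w → x ∈ pathVerts T u w
  btw⇒∈pathVerts {u} {x} {w} = toward-induction x (λ u → Btw u x w → x ∈ pathVerts T u w)
    (λ _ → start∈verts (proj₁ (path x w)))
    (λ {u} {v} nx ih h → subst (x ∈_) (sym (next⇒verts (next-extend nx h))) (there (ih (btw-inner (next⇒btw nx) h))))
    u

-- A relation replaces a function because partners come from existence proofs. Deleting the partner
-- of the head from `ys` costs one place, and injectivity ensures that no later element used that
-- place.
pigeonhole : {A B : Set} (R : A → B → Set) (xs : List A) (ys : List B) → Unique xs →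
             (∀ {x} → x ∈ xs → ∃[ y ] y ∈ ys × R x y) →
             (∀ {x x' y} → x ∈ xs → x' ∈ xs → R x y → R x' y → x ≡ x') →
             length xs ≤ length ys
pigeonhole R [] ys _ _ _ = z≤n
pigeonhole R (x ∷ xs) ys (x∉ ∷ U) f inj with f (here refl)
... | y , y∈ , r with ∈-∃++ y∈
... | as , bs , refl = subst (suc (length xs) ≤_) (sym (trans (length-++ as) (ℕₚ.+-suc (length as) (length bs))))
    (s≤s (subst (length xs ≤_) (length-++ as) (pigeonhole R xs (as ++ bs) U f' (λ a b → inj (there a) (there b)))))
  where
  f' : ∀ {x'} → x' ∈ xs → ∃[ y' ] y' ∈ as ++ bs × R x' y'
  f' x'∈ with f (there x'∈)
  ... | y' , y'∈ , r' with ∈-++⁻ as y'∈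
  ... | inj₁ ∈as = y' , ∈-++⁺ˡ ∈as , r'
  ... | inj₂ (there ∈bs) = y' , ∈-++⁺ʳ as ∈bs , r'
  ... | inj₂ (here refl) = contradiction (inj (here refl) (there x'∈) r r') (All.lookup x∉ x'∈)

-- Degrees, path graphs and legs.

module TreeShape {n : ℕ} (T : Tree n) where
  open Tree T
  open TreeMetric T

  neighbours : Fin n → List (Fin n)
  neighbours v = filterᵇ (E v) (allFin n)

  neighbours-unique : ∀ v → Unique (neighbours v)
  neighbours-unique v = filter⁺ (T? ∘ E v) (allFin⁺ n)

  edge⇒∈ : ∀ {v u} → E v u ≡ true → u ∈ neighbours v
  edge⇒∈ {v} {u} e = ∈-filter⁺ (T? ∘ E v) (∈-allFin u) (Equivalence.from T-≡ e)

  ∈⇒edge : ∀ {v u} → u ∈ neighbours v → E v u ≡ true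
  ∈⇒edge {v} u∈ = Equivalence.to T-≡ (proj₂ (∈-filter⁻ (T? ∘ E v) {xs = allFin n} u∈))

  major? : ∀ v → Dec (Major T v)
  major? v = 3 ℕₚ.≤? deg T v

  major-intro : ∀ {v a b c} → E v a ≡ true → E v b ≡ true → E v c ≡ true → a ≢ b → a ≢ c → b ≢ c → Major T v
  major-intro {v} {a} {b} {c} ea eb ec a≢b a≢c b≢c =
    pigeonhole _≡_ (a ∷ b ∷ c ∷ []) (neighbours v)
      ((a≢b ∷ a≢c ∷ []) ∷ (b≢c ∷ []) ∷ [] ∷ [])
      (λ { (here refl) → _ , edge⇒∈ ea , refl
         ; (there (here refl)) → _ , edge⇒∈ eb , refl
         ; (there (there (here refl))) → _ , edge⇒∈ ec , refl })
      (λ { _ _ refl refl → refl })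

  ThreeNeighbours : Fin n → Set
  ThreeNeighbours v = ∃[ a ] ∃[ b ] ∃[ c ] E v a ≡ true × E v b ≡ true × E v c ≡ true × a ≢ b × a ≢ c × b ≢ c

  major-elim : ∀ {v} → Major T v → ThreeNeighbours v
  major-elim {v} M = go (neighbours v) (neighbours-unique v) ∈⇒edge M
    where
    go : ∀ xs → Unique xs → (∀ {u} → u ∈ xs → E v u ≡ true) → 3 ≤ length xs → ThreeNeighbours v
    go (_ ∷ []) _ _ (s≤s ())
    go (_ ∷ _ ∷ []) _ _ (s≤s (s≤s ()))
    go (a ∷ b ∷ c ∷ _) ((a≢b ∷ a≢c ∷ _) ∷ (b≢c ∷ _) ∷ _) e _ =
      a , b , c , e (here refl) , e (there (here refl)) , e (there (there (here refl))) , a≢b , a≢c , b≢c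

  leaf-neighbour-unique : ∀ {v a b} → Leaf T v → E v a ≡ true → E v b ≡ true → a ≡ b
  leaf-neighbour-unique {v} L ea eb = go (neighbours v) L (edge⇒∈ ea) (edge⇒∈ eb)
    where
    go : ∀ {a b} xs → length xs ≡ 1 → a ∈ xs → b ∈ xs → a ≡ b
    go (_ ∷ []) _ (here refl) (here refl) = refl

  leaf-intro : ∀ {v a} → E v a ≡ true → (∀ {b} → E v b ≡ true → b ≡ a) → Leaf T v
  leaf-intro {v} {a} ea only = ≤-antisym
    (pigeonhole (λ b _ → b ≡ a) (neighbours v) (a ∷ []) (neighbours-unique v)
      (λ b∈ → a , here refl , only (∈⇒edge b∈)) (λ { _ _ refl refl → refl }))
    (pigeonhole _≡_ (a ∷ []) (neighbours v) ([] ∷ [])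
      (λ { (here refl) → a , edge⇒∈ ea , refl }) (λ { _ _ refl refl → refl }))

  -- A vertex strictly inside a path has two different neighbours on it.
  leaf-endpoint : ∀ {a z b} → Leaf T z → Btw a z b → z ≢ b → z ≡ a
  leaf-endpoint {a} {z} {b} L h z≢b with z ≟ a
  ... | yes eq = eq
  ... | no z≢a with next-exists z≢a | next-exists z≢b
  ... | _ , na | _ , nb = contradiction (leaf-neighbour-unique L (proj₁ na) (proj₁ nb)) (branches-≢ na nb h)

  branching⇒major : ∀ {m p q r} → m ≢ p → m ≢ q → m ≢ r → Btw p m q → Btw q m r → Btw p m r → Major T m
  branching⇒major m≢p m≢q m≢r pq qr pr with next-exists m≢p | next-exists m≢q | next-exists m≢r
  ... | _ , np | _ , nq | _ , nr =
    major-intro (proj₁ np) (proj₁ nq) (proj₁ nr) (branches-≢ np nq pq) (branches-≢ np nr pr) (branches-≢ nq nr qr)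

  -- Every edge points towards `q` in one direction, and along a path through all vertices that
  -- direction is the order of the list.
  consecutive⇔edge : ∀ p q → (∀ v → Btw p v q) → ∀ u w → (E u w ≡ true ⇔ Consecutive T (pathVerts T p q) u w)
  consecutive⇔edge p q onPath u w = mk⇔ to from
    where
    split : ∀ {u w} → Next u w q → ∃₂ λ as bs → pathVerts T p q ≡ as ++ u ∷ w ∷ bs
    split {u} {w} nx
      with suffix (proj₁ (path p q)) (proj₂ (path p q)) (btw⇒∈pathVerts (onPath u))
    ... | r , Ur , as , eq with verts-head (proj₁ (path w q))
      where
      verts-head : (r : Walk E w q) → ∃[ bs ] verts r ≡ w ∷ bs
      verts-head (stop _) = [] , refl
      verts-head (step _ _ _ r) = verts r , refl
    ... | bs , eq' = as , bs , trans eq (cong (as ++_) (trans (path-unique u q (r , Ur)) (trans (next⇒verts nx) (cong (u ∷_) eq'))))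
    to : E u w ≡ true → Consecutive T (pathVerts T p q) u w
    to e with edge-next e q
    ... | inj₁ nx with split nx
    ... | as , bs , eq = as , bs , inj₁ eq
    to e | inj₂ nx with split nx
    ... | as , bs , eq = as , bs , inj₂ eq
    from : Consecutive T (pathVerts T p q) u w → E u w ≡ true
    from (as , bs , inj₁ eq) = verts-consecutive (proj₁ (path p q)) as eq
    from (as , bs , inj₂ eq) = E-flip (verts-consecutive (proj₁ (path p q)) as eq)

  -- A branch leaving the path from `p` to `q` at an inner vertex would make that vertex major; one
  -- leaving at an end would prolong a longest path.
  diameter-spans : (∀ v → ¬ Major T v) → ∀ p q → (∀ x y → d x y ≤ d p q) → ∀ z → Btw p z q
  diameter-spans noMajor p q max z with median p q z
  ... | m , pmq , qmz , pmz with m ≟ z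
  ... | yes refl = pmq
  ... | no m≢z = contradiction (branching⇒major m≢p m≢q m≢z pmq qmz pmz) (noMajor m)
    where
    m≢p : m ≢ p
    m≢p refl = ℕₚ.<⇒≱ (btw-< qmz m≢z) (≤-trans (max q z) (≤-reflexive (d-sym p q)))
    m≢q : m ≢ q
    m≢q refl = ℕₚ.<⇒≱ (btw-< pmz m≢z) (max p z)

  majorless⇒pathGraph : (∀ v → ¬ Major T v) → IsPathGraph T
  majorless⇒pathGraph noMajor = go (any? {P = λ _ → ⊤} (λ _ → yes tt))
    where
    go : Dec (∃ λ (_ : Fin n) → ⊤) → IsPathGraph T
    -- Without vertices, the empty list witnesses a path graph.
    go (no empty) = [] , [] , (λ v → contradiction (v , tt) empty) , λ u _ → contradiction (u , tt) empty
    go (yes (v₀ , _)) = pathVerts T p q , proj₂ (path p q) , (λ v → btw⇒∈pathVerts (onPath v)) , consecutive⇔edge p q onPath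
      where
      -- A diameter is found as an iterated maximum: first the farthest vertex from each `u`, then a
      -- `u` of greatest eccentricity.
      farthest : ∀ u → ∃[ x ] ⊤ × (∀ y → ⊤ → d u y ≤ d u x)
      farthest u = maximiser {P = λ _ → ⊤} (λ _ → yes tt) (d u) (v₀ , tt)
      ecc : Fin n → ℕ
      ecc u = d u (proj₁ (farthest u))
      centre = maximiser {P = λ _ → ⊤} (λ _ → yes tt) ecc (v₀ , tt)
      p = proj₁ centre
      q = proj₁ (farthest p)
      onPath : ∀ z → Btw p z q
      onPath = diameter-spans noMajor p q
        (λ x y → ≤-trans (proj₂ (proj₂ (farthest x)) y tt) (proj₂ (proj₂ centre) x tt))

  abstract
    major-exists : ¬ IsPathGraph T → ∃ (Major T)
    major-exists ¬path with any? major?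
    ... | yes M = M
    ... | no none = contradiction (majorless⇒pathGraph (λ v M → none (v , M))) ¬path

  abstract
    terminal? : ∀ u t → Dec (Terminal T u t)
    terminal? u t = (deg T u ℕₚ.≟ 1) ×-dec major? t ×-dec
      all? (λ w → major? w →-dec (¬? (w ≟ t) →-dec (d u t ℕₚ.<? d u w)))

  terminal-owner : ∀ {u t t'} → Terminal T u t → Terminal T u t' → t ≡ t'
  terminal-owner {u} {t} {t'} (_ , M , near) (_ , M' , near') with t ≟ t'
  ... | yes eq = eq
  ... | no t≢t' = contradiction (near t' M' (≢-sym t≢t')) (ℕₚ.<-asym (near' t M t≢t'))

  leaf⇒¬major : ∀ {v} → Leaf T v → ¬ Major T v
  leaf⇒¬major L M = case subst (3 ≤_) L M of λ { (s≤s ()) }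

  -- If the path from u to z left the leg before t, it would do so at a major vertex closer to u than t.
  leg-contains : ∀ {u t z} → Terminal T u t → ¬ Btw u t z → Btw u z t
  leg-contains {u} {t} {z} (L , _ , near) ¬utz with median u t z
  ... | s , ust , tsz , usz with s ≟ z
  ... | yes refl = ust
  ... | no s≢z = contradiction (near s (branching⇒major s≢u s≢t s≢z ust tsz usz) s≢t)
                               (ℕₚ.<-asym (btw-< ust s≢t))
    where
    s≢t : s ≢ t
    s≢t refl = ¬utz usz
    s≢u : s ≢ u
    s≢u refl = s≢t (leaf-endpoint L tsz s≢z)

  -- Otherwise `w` would lie on the leg, hence no farther from `u` than `t` is.
  other-major-beyond : ∀ {u t w} → Terminal T u t → Major T w → w ≢ t → Btw u t w
  other-major-beyond {u} {t} {w} ter@(_ , _ , near) M w≢t = decidable-stable (btw? u t w)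
    (λ ¬h → ℕₚ.<⇒≱ (near w M w≢t) (subst (d u w ≤_) (leg-contains ter ¬h) (ℕₚ.m≤m+n _ _)))

  -- Otherwise the leaf `u'` would lie on the leg of `u`, where the only leaf is the end `u`.
  terminals-separated : ∀ {u u' t} → Terminal T u t → Terminal T u' t → u ≢ u' → Btw u t u'
  terminals-separated {u} {u'} {t} ter (L' , M , _) u≢u' = decidable-stable (btw? u t u')
    (λ ¬h → u≢u' (sym (leaf-endpoint L' (leg-contains ter ¬h) λ { refl → leaf⇒¬major L' M })))

  -- u is the end of the branch at its owner t that contains w.
  Hits : Fin n → Fin n → Set
  Hits w u = ∃[ t ] Terminal T u t × ¬ Btw u t w

  hits? : ∀ w u → Dec (Hits w u)
  hits? w u = any? (λ t → terminal? u t ×-dec ¬? (btw? u t w))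

  -- This charges each vertex of a resolving set to at most one leg. Two legs with the same owner
  -- meet only at the owner; for different owners, each owner would lie between `w` and the other.
  hits-injective : ∀ {w u u'} → Hits w u → Hits w u' → u ≡ u'
  hits-injective {w} {u} {u'} (t , ter , ¬h) (t' , ter' , ¬h') = decidable-stable (u ≟ u') separate
    where
    utw = leg-contains ter ¬h
    utw' = leg-contains ter' ¬h'
    separate : ¬ ¬ (u ≡ u')
    separate u≢u' with t ≟ t'
    ... | yes refl = ¬h (subst (Btw u t) t≡w (btw-right u t))
      where
      t≡w : t ≡ w
      t≡w = btw-antisym (btw-sym (btw-inner utw (terminals-separated ter ter' u≢u'))) utw'
    ... | no t≢t' = t≢t' (btw-antisym (btw-inner utw (other-major-beyond ter (proj₁ (proj₂ ter')) (≢-sym t≢t')))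
                                      (btw-inner utw' (other-major-beyond ter' (proj₁ (proj₂ ter)) t≢t')))

  abstract
    -- Choose `u` farthest from `t` among the vertices beyond `x`. Maximality leaves `u` only the
    -- neighbour towards `t`, and any other major vertex is reached from `u` through `t`.
    leg-end : ∀ {t a x} → Major T t → E t a ≡ true → Btw t a x → (∀ z → Major T z → ¬ Btw t a z) →
              ∃[ u ] Terminal T u t × Btw t x u
    leg-end {t} {a} {x} M ta tax noMajor with maximiser (btw? t x) (d t) (x , btw-right t x)
    ... | u , txu , furthest with next-exists (u≢t txu)
      where
      u≢t : ∀ {u} → Btw t x u → u ≢ t
      u≢t txt refl with btw-antisym (btw-left t x) txt
      ... | refl with btw-antisym (btw-left t a) tax
      ... | refl = edge-≢ ta refl
    ... | p , np = u , (leaf-intro (proj₁ np) only , M , near) , txu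
      where
      only : ∀ {q} → E u q ≡ true → q ≡ p
      only {q} uq with edge-next uq t
      ... | inj₁ nq = next-unique nq np
      ... | inj₂ nq = contradiction (furthest q (btw-outer txu tuq)) (ℕₚ.<⇒≱ (btw-< tuq (edge-≢ uq)))
        where
        tuq : Btw t u q
        tuq = btw-sym (next⇒btw nq)
      near : ∀ w → Major T w → w ≢ t → d u t < d u w
      near w M' w≢t with edge-next ta w
      ... | inj₁ nw = contradiction (next⇒btw nw) (noMajor w M')
      ... | inj₂ nw = btw-< (away (btw⇒next ta (btw-outer tax txu)) nw) (≢-sym w≢t)

  abstract
    -- At most one of three neighbours of `t` is the first step towards `r`.
    two-children : ∀ {t} → Major T t → ∀ r → ∃₂ λ a b → Next a t r × Next b t r × a ≢ b
    two-children M r with major-elim M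
    ... | a , b , c , ta , tb , tc , a≢b , a≢c , b≢c with edge-next ta r | edge-next tb r | edge-next tc r
    ... | inj₂ na | inj₂ nb | _       = a , b , na , nb , a≢b
    ... | inj₂ na | inj₁ _  | inj₂ nc = a , c , na , nc , a≢c
    ... | inj₁ _  | inj₂ nb | inj₂ nc = b , c , nb , nc , b≢c
    ... | inj₁ pa | inj₁ pb | _       = contradiction (next-unique pa pb) a≢b
    ... | inj₁ pa | _       | inj₁ pc = contradiction (next-unique pa pc) a≢c
    ... | _       | inj₁ pb | inj₁ pc = contradiction (next-unique pb pc) b≢c

  -- Take t farthest from r: the branches at t away from r then contain no major vertex, so they are legs.
  abstract
    deep-legs : ∀ r {t₀} → Major T t₀ →
                ∃[ t ] Major T t × Btw r t₀ t × ∃₂ λ u u' → Terminal T u t × Terminal T u' t × u ≢ u'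
    deep-legs r {t₀} M₀ with maximiser (λ t → major? t ×-dec btw? r t₀ t) (d r) (t₀ , M₀ , btw-right r t₀)
    ... | t , (M , rt₀t) , deepest with two-children M r
    ... | a , b , na , nb , a≢b with child-leg na | child-leg nb
      where
      child-leg : ∀ {a} → Next a t r → ∃[ u ] Terminal T u t × Btw t a u
      child-leg {a} na = leg-end M ta (btw-right t a) noMajor
        where
        ta : E t a ≡ true
        ta = E-flip (proj₁ na)
        noMajor : ∀ z → Major T z → ¬ Btw t a z
        noMajor z Mz taz = ℕₚ.<⇒≱ (btw-< rtz t≢z) (deepest z (Mz , btw-outer rt₀t rtz))
          where
          nz : Next t a z
          nz = btw⇒next ta taz
          rtz : Btw r t z
          rtz = btw-sym (away nz na)
          t≢z : t ≢ z
          t≢z refl = case trans (sym (d-refl t)) (proj₂ nz) of λ ()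
    ... | u , ter , tau | u' , ter' , tbu' = t , M , rt₀t , u , u' , ter , ter' , u≢u'
      where
      u≢u' : u ≢ u'
      u≢u' refl = a≢b (next-unique (btw⇒next (E-flip (proj₁ na)) tau) (btw⇒next (E-flip (proj₁ nb)) tbu'))

filter-split : {A : Set} {P : A → Set} (P? : Decidable P) (xs : List A) →
               length xs ≡ length (filter P? xs) + length (filter (¬? ∘ P?) xs)
filter-split P? [] = refl
filter-split P? (x ∷ xs) with P? x
... | yes _ = cong suc (filter-split P? xs)
... | no  _ = trans (cong suc (filter-split P? xs)) (sym (ℕₚ.+-suc _ _))

map-≡⇒pointwise : {A B : Set} {f g : A → B} {xs : List A} → map f xs ≡ map g xs → ∀ {x} → x ∈ xs → f x ≡ g x
map-≡⇒pointwise eq (here refl) = ∷-injectiveˡ eq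
map-≡⇒pointwise eq (there x∈)  = map-≡⇒pointwise (∷-injectiveʳ eq) x∈

three-signs : (r s t : Sign) → r ≢ s → r ≢ t → ¬ (s ≢ t)
three-signs Sign.- Sign.- _      p _ _ = p refl
three-signs Sign.+ Sign.+ _      p _ _ = p refl
three-signs Sign.- Sign.+ Sign.- _ q _ = q refl
three-signs Sign.- Sign.+ Sign.+ _ _ r = r refl
three-signs Sign.+ Sign.- Sign.- _ _ r = r refl
three-signs Sign.+ Sign.- Sign.+ _ q _ = q refl

-- Signs along paths and signed distances.

module SignedMetric {n : ℕ} {T : Tree n} (S : Signing T) where
  open Tree T
  open Signing S
  open TreeMetric T

  sg : Fin n → Fin n → Sign
  sg u v = wsign σ (proj₁ (path u v))

  next-sign : ∀ {u v w} → Next u v w → sg u w ≡ σ u v *ˢ sg v w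
  next-sign {u} {v} {w} nx@(e , _) =
    wsign-cong σ (proj₁ (path u w)) (step u v e (proj₁ (path v w))) (next⇒verts nx)

  sign-refl : ∀ u → sg u u ≡ Sign.+
  sign-refl u = sym (wsign-cong σ (stop u) (proj₁ (path u u)) (path-unique u u (stop u , [] ∷ [])))

  btw-sign : ∀ {a b c} → Btw a b c → sg a c ≡ sg a b *ˢ sg b c
  btw-sign {a} {b} {c} = toward-induction b (λ a → Btw a b c → sg a c ≡ sg a b *ˢ sg b c)
    (λ _ → sym (cong (_*ˢ sg b c) (sign-refl b)))
    (λ {u} {v} nx ih h → begin
      sg u c                        ≡⟨ next-sign (next-extend nx h) ⟩
      σ u v *ˢ sg v c               ≡⟨ cong (σ u v *ˢ_) (ih (btw-inner (next⇒btw nx) h)) ⟩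
      σ u v *ˢ (sg v b *ˢ sg b c)   ≡⟨ sym (Sₚ.*-assoc (σ u v) _ _) ⟩
      (σ u v *ˢ sg v b) *ˢ sg b c   ≡⟨ cong (_*ˢ sg b c) (sym (next-sign nx)) ⟩
      sg u b *ˢ sg b c              ∎)
    a
    where open ≡-Reasoning

  edge-sign : ∀ {u v} → E u v ≡ true → sg u v ≡ σ u v
  edge-sign {u} {v} e = trans (next-sign (e , trans (edge-d e) (cong suc (sym (d-refl v)))))
    (trans (cong (σ u v *ˢ_) (sign-refl v)) (Sₚ.*-identityʳ _))

  sign-sym : ∀ a b → sg a b ≡ sg b a
  sign-sym a b = toward-induction b (λ a → sg a b ≡ sg b a) refl
    (λ {u} {v} nx ih → begin
      sg u b            ≡⟨ next-sign nx ⟩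
      σ u v *ˢ sg v b   ≡⟨ cong₂ _*ˢ_ (σ-sym u v) ih ⟩
      σ v u *ˢ sg b v   ≡⟨ Sₚ.*-comm (σ v u) _ ⟩
      sg b v *ˢ σ v u   ≡⟨ cong (sg b v *ˢ_) (sym (edge-sign (E-flip (proj₁ nx)))) ⟩
      sg b v *ˢ sg v u  ≡⟨ sym (btw-sign (btw-sym (next⇒btw nx))) ⟩
      sg b u            ∎)
    a
    where open ≡-Reasoning

  sdist⇒d : ∀ {x y w w'} → sdist S x w ≡ sdist S y w' → d x w ≡ d y w'
  sdist⇒d {x} {y} {w} {w'} eq = trans (sym (abs-◃ (sg x w) _)) (trans (cong ∣_∣ eq) (abs-◃ (sg y w') _))

  -- `_◃_` forgets the sign at distance zero, hence the positivity assumption.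
  sdist⇒sign : ∀ {x y w w'} → sdist S x w ≡ sdist S y w' → 1 ≤ d x w → sg x w ≡ sg y w'
  sdist⇒sign {x} {y} {w} {w'} eq pos = sign-cong {{>-nonZero pos}} {{>-nonZero (subst (1 ≤_) (sdist⇒d eq) pos)}} eq

  sdist-cong : ∀ {x y w w'} → sg x w ≡ sg y w' → d x w ≡ d y w' → sdist S x w ≡ sdist S y w'
  sdist-cong = cong₂ _◃_

  -- Both paths end with the common stretch from `t` to `w`, which multiplies both signs and
  -- lengthens both distances alike.
  sdist-through : ∀ {t x y w} → sdist S t x ≡ sdist S t y → 1 ≤ d t x → Btw x t w → Btw y t w → sdist S x w ≡ sdist S y w
  sdist-through {t} {x} {y} {w} eq pos xtw ytw = sdist-cong
    (trans (btw-sign xtw) (trans (cong (_*ˢ sg t w) (trans (sign-sym x t) (trans (sdist⇒sign eq pos) (sign-sym t y)))) (sym (btw-sign ytw))))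
    (trans (sym xtw) (trans (cong (_+ d t w) (trans (d-sym x t) (trans (sdist⇒d eq) (d-sym t y)))) ytw))

  -- The common stretch cancels, in the group of signs as in the lengths.
  sdist-through⁻ : ∀ {t x y w} → sdist S x w ≡ sdist S y w → 1 ≤ d x w → Btw x t w → Btw y t w → sdist S t x ≡ sdist S t y
  sdist-through⁻ {t} {x} {y} {w} eq pos xtw ytw = sdist-cong
    (trans (sign-sym t x) (trans (Sₚ.*-cancelʳ-≡ (sg t w) _ _ (trans (sym (btw-sign xtw)) (trans (sdist⇒sign eq pos) (btw-sign ytw)))) (sign-sym y t)))
    (trans (d-sym t x) (trans (ℕₚ.+-cancelʳ-≡ (d t w) _ _ (trans xtw (trans (sdist⇒d eq) (sym ytw)))) (d-sym y t)))

  -- The last clause of `Special` for one fixed pair of legs: at equal index only the signs can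
  -- differ.
  Opposite : Fin n → Fin n → Fin n → Set
  Opposite t u u' = ∀ x y → x ∈ pathVerts T t u → y ∈ pathVerts T t u' →
                    d t x ≡ d t y → 1 ≤ d t x → sdist S t x ≢ sdist S t y

  opposite-sym : ∀ {t u u'} → Opposite t u u' → Opposite t u' u
  opposite-sym opp x y x∈ y∈ eq pos s = opp y x y∈ x∈ (sym eq) (subst (1 ≤_) eq pos) (sym s)

-- The terminal vertices and exterior major vertices to be counted.

module Legs {n : ℕ} (T : Tree n) where
  open TreeShape T

  abstract
    ownedLeaf? : ∀ u → Dec (∃ λ t → Terminal T u t)
    ownedLeaf? u = any? (terminal? u)

    exteriorMajor? : ∀ t → Dec (∃ λ u → Terminal T u t)
    exteriorMajor? t = any? (λ u → terminal? u t)

  ownedLeaves : List (Fin n)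
  ownedLeaves = filter ownedLeaf? (allFin n)

  exteriorMajors : List (Fin n)
  exteriorMajors = filter exteriorMajor? (allFin n)

  ownedLeaves-unique : Unique ownedLeaves
  ownedLeaves-unique = filter⁺ ownedLeaf? (allFin⁺ n)

  exteriorMajors-unique : Unique exteriorMajors
  exteriorMajors-unique = filter⁺ exteriorMajor? (allFin⁺ n)

  ∈ownedLeaves : ∀ {u t} → Terminal T u t → u ∈ ownedLeaves
  ∈ownedLeaves {u} {t} ter = ∈-filter⁺ ownedLeaf? (∈-allFin u) (t , ter)

  ownedLeaves⇒owner : ∀ {u} → u ∈ ownedLeaves → ∃ λ t → Terminal T u t
  ownedLeaves⇒owner u∈ = proj₂ (∈-filter⁻ ownedLeaf? {xs = allFin n} u∈)

  ∈exteriorMajors : ∀ {u t} → Terminal T u t → t ∈ exteriorMajors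
  ∈exteriorMajors {u} {t} ter = ∈-filter⁺ exteriorMajor? (∈-allFin t) (u , ter)

  exteriorMajors⇒terminal : ∀ {t} → t ∈ exteriorMajors → ∃ λ u → Terminal T u t
  exteriorMajors⇒terminal t∈ = proj₂ (∈-filter⁻ exteriorMajor? {xs = allFin n} t∈)

  terminal≢owner : ∀ {u t} → Terminal T u t → t ≢ u
  terminal≢owner (L , M , _) refl = leaf⇒¬major L M

-- Lower bound: the legs that a resolving set can miss.

module LowerBound {n : ℕ} {T : Tree n} (S : Signing T) (W : List (Fin n)) (resolves : SResolving S W) where
  open TreeMetric T
  open TreeShape T
  open SignedMetric S
  open Legs T

  Hit : Fin n → Set
  Hit u = Any (λ w → Hits w u) W

  abstract
    hit? : Decidable Hit
    hit? u = Any.any? (λ w → hits? w u) W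

  unhit⇒btw : ∀ {u t w} → Terminal T u t → ¬ Hit u → w ∈ W → Btw u t w
  unhit⇒btw {u} {t} {w} ter ¬hit w∈ = decidable-stable (btw? u t w) (λ ¬h → ¬hit (lose w∈ (t , ter , ¬h)))

  -- All of `W` lies beyond `t` from both legs, so equal signed distances from `t` would leave `x`
  -- and `y` unseparated, hence equal. A common vertex of the two legs is `t`, of index 0.
  unhit-opposite : ∀ {t u u'} → Terminal T u t → Terminal T u' t → u ≢ u' → ¬ Hit u → ¬ Hit u' → Opposite t u u'
  unhit-opposite {t} {u} {u'} ter ter' u≢u' ¬hit ¬hit' x y x∈ y∈ _ pos s
    with resolves x y (map-cong-local (All.tabulate λ w∈ → sdist-through s pos
           (btw-inner uxt (unhit⇒btw ter ¬hit w∈)) (btw-inner u'yt (unhit⇒btw ter' ¬hit' w∈))))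
    where
    uxt = btw-sym (∈pathVerts⇒btw x∈)
    u'yt = btw-sym (∈pathVerts⇒btw y∈)
  ... | refl with btw-antisym (btw-sym (btw-inner (btw-sym (∈pathVerts⇒btw x∈)) (terminals-separated ter ter' u≢u')))
                              (btw-sym (∈pathVerts⇒btw y∈))
  ... | refl = case subst (1 ≤_) (d-refl t) pos of λ ()

  -- The first edges of three legs cannot carry three different signs.
  no-three-unhit : ∀ {t u₁ u₂ u₃} → Terminal T u₁ t → Terminal T u₂ t → Terminal T u₃ t →
                   u₁ ≢ u₂ → u₁ ≢ u₃ → u₂ ≢ u₃ → ¬ Hit u₁ → ¬ Hit u₂ → ¬ ¬ Hit u₃
  no-three-unhit {t} ter₁ ter₂ ter₃ ≢₁₂ ≢₁₃ ≢₂₃ ¬h₁ ¬h₂ ¬h₃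
    with next-exists (terminal≢owner ter₁) | next-exists (terminal≢owner ter₂) | next-exists (terminal≢owner ter₃)
  ... | x₁ , n₁ | x₂ , n₂ | x₃ , n₃ = three-signs (sg t x₁) (sg t x₂) (sg t x₃)
      (differ n₁ n₂ (unhit-opposite ter₁ ter₂ ≢₁₂ ¬h₁ ¬h₂))
      (differ n₁ n₃ (unhit-opposite ter₁ ter₃ ≢₁₃ ¬h₁ ¬h₃))
      (differ n₂ n₃ (unhit-opposite ter₂ ter₃ ≢₂₃ ¬h₂ ¬h₃))
    where
    differ : ∀ {x y u u'} → Next t x u → Next t y u' → Opposite t u u' → sg t x ≢ sg t y
    differ {x} {y} nx ny opp eq = opp x y (btw⇒∈pathVerts (next⇒btw nx)) (btw⇒∈pathVerts (next⇒btw ny)) deq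
      (≤-reflexive (sym (edge-d (proj₁ nx)))) (sdist-cong eq deq)
      where deq = trans (edge-d (proj₁ nx)) (sym (edge-d (proj₁ ny)))

  -- The numbering of the vertices singles out one first unhit leg at each owner that has any.
  Later : Fin n → Set
  Later u = ∃₂ λ u' t → u' Fin.< u × ¬ Hit u' × Terminal T u' t × Terminal T u t

  abstract
    later? : Decidable Later
    later? u = any? λ u' → any? λ t → (u' Finₚ.<? u) ×-dec ¬? (hit? u') ×-dec terminal? u' t ×-dec terminal? u t

  -- Hit legs are charged to `W`, first unhit legs to their owners, and later unhit legs to their
  -- owners as special vertices: an earlier unhit leg completes the witnessing pair.
  bound : (η : List (Fin n)) → (∀ t → Special S t → t ∈ η) →
          length ownedLeaves ≤ length W + (length exteriorMajors + length η)
  bound η special∈ = begin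
      length ownedLeaves
        ≡⟨ filter-split hit? ownedLeaves ⟩
      length (filter hit? ownedLeaves) + length unhit
        ≡⟨ cong (length (filter hit? ownedLeaves) +_) (filter-split later? unhit) ⟩
      length (filter hit? ownedLeaves) + (length (filter later? unhit) + length (filter (¬? ∘ later?) unhit))
        ≡⟨ cong (length (filter hit? ownedLeaves) +_) (+-comm (length (filter later? unhit)) _) ⟩
      length (filter hit? ownedLeaves) + (length (filter (¬? ∘ later?) unhit) + length (filter later? unhit))
        ≤⟨ ℕₚ.+-mono-≤ hit≤ (ℕₚ.+-mono-≤ first≤ later≤) ⟩
      length W + (length exteriorMajors + length η) ∎
    where
    open ℕₚ.≤-Reasoning
    unhit = filter (¬? ∘ hit?) ownedLeaves
    unhit-unique : Unique unhit
    unhit-unique = filter⁺ (¬? ∘ hit?) ownedLeaves-unique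
    unhit⁻ : ∀ {u} → u ∈ unhit → u ∈ ownedLeaves × ¬ Hit u
    unhit⁻ = ∈-filter⁻ (¬? ∘ hit?) {xs = ownedLeaves}

    hit≤ : length (filter hit? ownedLeaves) ≤ length W
    hit≤ = pigeonhole (λ u w → Hits w u) _ W (filter⁺ hit? ownedLeaves-unique)
      (λ u∈ → find (proj₂ (∈-filter⁻ hit? {xs = ownedLeaves} u∈)))
      (λ _ _ → hits-injective)

    first≤ : length (filter (¬? ∘ later?) unhit) ≤ length exteriorMajors
    first≤ = pigeonhole (Terminal T) _ exteriorMajors (filter⁺ (¬? ∘ later?) unhit-unique) owner same
      where
      first⁻ : ∀ {u} → u ∈ filter (¬? ∘ later?) unhit → u ∈ unhit × ¬ Later u
      first⁻ = ∈-filter⁻ (¬? ∘ later?) {xs = unhit}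
      owner : ∀ {u} → u ∈ filter (¬? ∘ later?) unhit → ∃[ t ] t ∈ exteriorMajors × Terminal T u t
      owner u∈ with ownedLeaves⇒owner (proj₁ (unhit⁻ (proj₁ (first⁻ u∈))))
      ... | t , ter = t , ∈exteriorMajors ter , ter
      same : ∀ {u v t} → u ∈ filter (¬? ∘ later?) unhit → v ∈ filter (¬? ∘ later?) unhit →
             Terminal T u t → Terminal T v t → u ≡ v
      same {u} {v} {t} u∈ v∈ ter ter' with Finₚ.<-cmp u v
      ... | tri< u<v _ _ = contradiction (u , t , u<v , proj₂ (unhit⁻ (proj₁ (first⁻ u∈))) , ter , ter') (proj₂ (first⁻ v∈))
      ... | tri≈ _ eq _  = eq
      ... | tri> _ _ v<u = contradiction (v , t , v<u , proj₂ (unhit⁻ (proj₁ (first⁻ v∈))) , ter' , ter) (proj₂ (first⁻ u∈))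

    later≤ : length (filter later? unhit) ≤ length η
    later≤ = pigeonhole (Terminal T) _ η (filter⁺ later? unhit-unique) owner same
      where
      later⁻ : ∀ {u} → u ∈ filter later? unhit → ¬ Hit u × Later u
      later⁻ u∈ with ∈-filter⁻ later? {xs = unhit} u∈
      ... | u∈' , later = proj₂ (unhit⁻ u∈') , later
      owner : ∀ {u} → u ∈ filter later? unhit → ∃[ t ] t ∈ η × Terminal T u t
      owner {u} u∈ with later⁻ u∈
      ... | ¬hit , u' , t , u'<u , ¬hit' , ter' , ter = t
        , special∈ t ((proj₁ (proj₂ ter) , u , ter) , u' , u , ter' , ter , Finₚ.<⇒≢ u'<u
                     , unhit-opposite ter' ter (Finₚ.<⇒≢ u'<u) ¬hit' ¬hit)
        , ter
      clash : ∀ {u v t} → u ∈ filter later? unhit → v ∈ filter later? unhit →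
              Terminal T u t → Terminal T v t → ¬ u Fin.< v
      clash {u} {v} u∈ v∈ ter ter' u<v with later⁻ u∈ | later⁻ v∈
      ... | ¬hit , u' , t' , u'<u , ¬hit' , terᵘ' , terᵘ | ¬hitᵛ , _ with terminal-owner ter terᵘ
      -- The earlier unhit leg `u'` joins `u` and `v` to make three unhit legs at one owner.
      ... | refl = no-three-unhit terᵘ' ter ter' (Finₚ.<⇒≢ u'<u) (Finₚ.<⇒≢ (Finₚ.<-trans u'<u u<v)) (Finₚ.<⇒≢ u<v) ¬hit' ¬hit ¬hitᵛ
      same : ∀ {u v t} → u ∈ filter later? unhit → v ∈ filter later? unhit →
             Terminal T u t → Terminal T v t → u ≡ v
      same {u} {v} u∈ v∈ ter ter' with Finₚ.<-cmp u v
      ... | tri< u<v _ _ = contradiction u<v (clash u∈ v∈ ter ter')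
      ... | tri≈ _ eq _  = eq
      ... | tri> _ _ v<u = contradiction v<u (clash v∈ u∈ ter' ter)

-- A sufficient condition for a set of leaves to resolve.

module Separation {n : ℕ} {T : Tree n} (S : Signing T) (hasMajor : ∃ (Major T)) (W : List (Fin n))
  (W-leaf : ∀ {w} → w ∈ W → Leaf T w)
  (two-legs⇒kept : ∀ {t u u'} → Terminal T u t → Terminal T u' t → u ≢ u' → ∃[ w ] w ∈ W × Terminal T w t)
  (missing-opposite : ∀ {t u u'} → Terminal T u t → Terminal T u' t → u ≢ u' → u ∉ W → u' ∉ W →
                      SignedMetric.Opposite S t u u') where
  open TreeMetric T
  open TreeShape T
  open SignedMetric S

  -- A deepest major vertex `s` beyond `t` has two legs, so a terminal vertex of `s` is kept, and
  -- `s` lies between it and `r`.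
  beyond-major : ∀ {r t} → Major T r → Major T t → ∃[ w ] w ∈ W × Btw r t w
  beyond-major {r} Mr Mt with deep-legs r Mt
  ... | s , Ms , rts , u , u' , ter , ter' , u≢u' with two-legs⇒kept ter ter' u≢u'
  ... | w , w∈ , terʷ = w , w∈ , btw-outer rts rsw
    where
    rsw : Btw r s w
    rsw with r ≟ s
    ... | yes refl = btw-left s w
    ... | no r≢s = btw-sym (other-major-beyond terʷ Mr r≢s)

  -- If `w` lay in the branch of `x`, the path from `y` to `w` would pass `m`. Equal distances would
  -- then force the path from `x` through `m` too, although `x` and `w` share a branch there.
  W-avoids : ∀ {m a b x y w} → Next m a x → Next m b y → a ≢ b → d x m ≡ d y m → d x w ≡ d y w → ¬ Btw m a w
  W-avoids {m} {a} {b} {x} {y} {w} na nb a≢b deq weq maw = branches-≢ na nw xmw refl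
    where
    nw = btw⇒next (proj₁ na) maw
    xmw : Btw x m w
    xmw = trans (cong (_+ d m w) deq) (trans (away′ nb nw (≢-sym a≢b)) (sym weq))

  -- If x and y are not separated, the branches at their meeting point m with the vertices
  -- of W are free of W, hence free of major vertices, hence legs of m.
  resolves : SResolving S W
  resolves x y eq = decidable-stable (x ≟ y) unresolved
    where
    same : ∀ {w} → w ∈ W → sdist S x w ≡ sdist S y w
    same = map-≡⇒pointwise eq

    branch-leg : ∀ {m a b p q} → Major T m → Next m a p → Next m b q → a ≢ b → d p m ≡ d q m →
                 (∀ {w} → w ∈ W → d p w ≡ d q w) → ∃[ u ] Terminal T u m × Btw m p u × u ∉ W
    branch-leg {m} {a} M na nb a≢b deq weq with leg-end M (proj₁ na) (next⇒btw na) noMajor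
      where
      noMajor : ∀ z → Major T z → ¬ Btw m a z
      noMajor z Mz maz with beyond-major M Mz
      ... | w , w∈ , mzw = W-avoids na nb a≢b deq (weq w∈) (btw-outer maz mzw)
    ... | u , ter , mpu = u , ter , mpu , λ u∈ → W-avoids na nb a≢b deq (weq u∈) (btw-outer (next⇒btw na) mpu)

    unresolved : ¬ ¬ (x ≡ y)
    -- Using one major vertex twice merely yields some element of `W`.
    unresolved x≢y with beyond-major (proj₂ hasMajor) (proj₂ hasMajor)
    ... | w , w∈ , _ with median x y w
    ... | m , xmy , ymw , xmw = conclude (next-exists m≢x) (next-exists m≢y)
      where
      deq : d x m ≡ d y m
      deq = ℕₚ.+-cancelʳ-≡ (d m w) _ _ (trans xmw (trans (sdist⇒d (same w∈)) (sym ymw)))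
      m≢x : m ≢ x
      m≢x refl = x≢y (sym (d≡0⇒≡ (trans (sym deq) (d-refl x))))
      m≢y : m ≢ y
      m≢y refl = x≢y (d≡0⇒≡ (trans deq (d-refl y)))
      -- The leaf `w` cannot lie strictly inside the path from `x` to `y`.
      m≢w : m ≢ w
      m≢w refl = m≢x (leaf-endpoint (W-leaf w∈) xmy m≢y)
      M : Major T m
      M = branching⇒major m≢x m≢y m≢w xmy ymw xmw
      sdist-m : sdist S m x ≡ sdist S m y
      sdist-m = sdist-through⁻ (same w∈) (≤-trans (d>0 (≢-sym m≢x)) (subst (d x m ≤_) xmw (ℕₚ.m≤m+n _ _))) xmw ymw

      Leg : Fin n → Set
      Leg p = ∃[ u ] Terminal T u m × Btw m p u × u ∉ W

      legs-clash : ∀ {a b} → Next m a x → Next m b y → Leg x → Leg y → ⊥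
      legs-clash na nb (u , ter , mxu , u∉) (v , ter' , myv , v∉) =
        missing-opposite ter ter' u≢v u∉ v∉ x y (btw⇒∈pathVerts mxu) (btw⇒∈pathVerts myv)
          (trans (d-sym m x) (trans deq (d-sym y m))) (d>0 m≢x) sdist-m
        where
        u≢v : u ≢ v
        u≢v refl = branches-≢ na nb xmy (next-unique (next-extend na mxu) (next-extend nb myv))

      conclude : ∃ (λ a → Next m a x) → ∃ (λ b → Next m b y) → ⊥
      conclude (a , na) (b , nb) = legs-clash na nb
          (branch-leg M na nb a≢b deq (λ z∈ → sdist⇒d (same z∈)))
          (branch-leg M nb na (≢-sym a≢b) (sym deq) (λ z∈ → sym (sdist⇒d (same z∈))))
        where
        a≢b : a ≢ b
        a≢b = branches-≢ na nb xmy

-- Upper bound: a resolving set obtained by omitting legs.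

module UpperBound {n : ℕ} {T : Tree n} (S : Signing T) (hasMajor : ∃ (Major T))
  (ter≢2 : ∀ t → Special S t → ¬ TerDeg T t 2)
  (η : List (Fin n)) (η⇔special : ∀ t → (t ∈ η ⇔ Special S t)) where
  open TreeShape T
  open SignedMetric S
  open Legs T

  -- e₁ and e₂ are the terminal vertices of t left out of the resolving set; they coincide
  -- unless t is special.
  Omission : Fin n → Fin n → Fin n → Set
  Omission t e₁ e₂ = ((∃ λ u → Terminal T u t) → Terminal T e₁ t) ×
    ((t ∈ η × Terminal T e₁ t × Terminal T e₂ t × e₁ ≢ e₂ × Opposite t e₁ e₂) ⊎ (t ∉ η × e₁ ≡ e₂))

  abstract
    omission : ∀ t → ∃₂ (Omission t)
    omission t with _∈?_ _≟_ t η
    ... | yes t∈ with Equivalence.to (η⇔special t) t∈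
    ... | _ , u , u' , ter , ter' , u≢u' , opp = u , u' , (λ _ → ter) , inj₁ (t∈ , ter , ter' , u≢u' , opp)
    omission t | no t∉ with exteriorMajor? t
    ... | yes (u , ter) = u , u , (λ _ → ter) , inj₂ (t∉ , refl)
    -- A default pair: `t` owns no leg, so the conditional first component is vacuous.
    ... | no none = t , t , (λ ex → contradiction ex none) , inj₂ (t∉ , refl)

  e₁ e₂ : Fin n → Fin n
  e₁ t = proj₁ (omission t)
  e₂ t = proj₁ (proj₂ (omission t))

  omitted : ∀ t → Omission t (e₁ t) (e₂ t)
  omitted t = proj₂ (proj₂ (omission t))

  First Second : Fin n → Set
  First u = ∃ λ t → Terminal T u t × u ≡ e₁ t
  Second u = ∃ λ t → Terminal T u t × u ≡ e₂ t

  abstract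
    first? : Decidable First
    first? u = any? (λ t → terminal? u t ×-dec (u ≟ e₁ t))

    second? : Decidable Second
    second? u = any? (λ t → terminal? u t ×-dec (u ≟ e₂ t))

  -- Omitting in two stages keeps the counts disjoint: at an owner that is not special the second
  -- stage removes nothing.
  notFirst W : List (Fin n)
  notFirst = filter (¬? ∘ first?) ownedLeaves
  W = filter (¬? ∘ second?) notFirst

  W⊆ownedLeaves : ∀ {w} → w ∈ W → w ∈ ownedLeaves
  W⊆ownedLeaves w∈ = proj₁ (∈-filter⁻ (¬? ∘ first?) {xs = ownedLeaves} (proj₁ (∈-filter⁻ (¬? ∘ second?) {xs = notFirst} w∈)))

  W-leaf : ∀ {w} → w ∈ W → Leaf T w
  W-leaf w∈ = proj₁ (proj₂ (ownedLeaves⇒owner (W⊆ownedLeaves w∈)))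

  kept : ∀ {u t} → Terminal T u t → u ≢ e₁ t → u ≢ e₂ t → u ∈ W
  kept {u} {t} ter ≢₁ ≢₂ = ∈-filter⁺ (¬? ∘ second?)
    (∈-filter⁺ (¬? ∘ first?) (∈ownedLeaves ter) λ { (t' , ter' , eq) → ≢₁ (trans eq (cong e₁ (terminal-owner ter' ter))) })
    λ { (t' , ter' , eq) → ≢₂ (trans eq (cong e₂ (terminal-owner ter' ter))) }

  not-kept : ∀ {u t} → Terminal T u t → u ∉ W → u ≡ e₁ t ⊎ u ≡ e₂ t
  not-kept {u} {t} ter u∉ with u ≟ e₁ t | u ≟ e₂ t
  ... | yes eq | _      = inj₁ eq
  ... | no _   | yes eq = inj₂ eq
  ... | no ≢₁  | no ≢₂  = contradiction (kept ter ≢₁ ≢₂) u∉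

  -- An ordinary owner loses one leg, so one of any two survives. A special owner loses two, so a
  -- third leg has to exist.
  two-legs⇒kept : ∀ {t u u'} → Terminal T u t → Terminal T u' t → u ≢ u' → ∃[ w ] w ∈ W × Terminal T w t
  two-legs⇒kept {t} {u} {u'} ter ter' u≢u' = [ special , ordinary ]′ (proj₂ (omitted t))
    where
    ordinary : t ∉ η × e₁ t ≡ e₂ t → ∃[ w ] w ∈ W × Terminal T w t
    ordinary (_ , e≡) = pick (u ≟ e₁ t)
      where
      pick : Dec (u ≡ e₁ t) → ∃[ w ] w ∈ W × Terminal T w t
      pick (no u≢e)  = u , kept ter u≢e (λ eq → u≢e (trans eq (sym e≡))) , ter
      pick (yes u≡e) = u' , kept ter' (λ eq → u≢u' (trans u≡e (sym eq))) (λ eq → u≢u' (trans u≡e (trans e≡ (sym eq)))) , ter'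
    special : t ∈ η × Terminal T (e₁ t) t × Terminal T (e₂ t) t × e₁ t ≢ e₂ t × Opposite t (e₁ t) (e₂ t) →
              ∃[ w ] w ∈ W × Terminal T w t
    special (t∈ , ter₁ , ter₂ , e≢ , _) =
      pick (any? (λ w → terminal? w t ×-dec ¬? (w ≟ e₁ t) ×-dec ¬? (w ≟ e₂ t)))
      where
      pick : Dec (∃ λ w → Terminal T w t × w ≢ e₁ t × w ≢ e₂ t) → ∃[ w ] w ∈ W × Terminal T w t
      pick (yes (w , terʷ , ≢₁ , ≢₂)) = w , kept terʷ ≢₁ ≢₂ , terʷ
      -- If the omitted pair exhausts the legs, the special vertex `t` has terminal degree 2,
      -- against `ter≢2`.
      pick (no none) = contradiction
        (e₁ t ∷ e₂ t ∷ [] , (e≢ ∷ []) ∷ [] ∷ []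
        , (λ v → mk⇔ (λ { (here refl) → ter₁ ; (there (here refl)) → ter₂ }) (exhausts v)) , refl)
        (ter≢2 t (Equivalence.to (η⇔special t) t∈))
        where
        exhausts : ∀ v → Terminal T v t → v ∈ e₁ t ∷ e₂ t ∷ []
        exhausts v terᵛ with v ≟ e₁ t | v ≟ e₂ t
        ... | yes eq | _      = here eq
        ... | no _   | yes eq = there (here eq)
        ... | no ≢₁  | no ≢₂  = contradiction (v , terᵛ , ≢₁ , ≢₂) none

  -- Two distinct legs are missing only at a special owner, where they are the witnessing pair in
  -- one of its two orders.
  missing-opposite : ∀ {t u u'} → Terminal T u t → Terminal T u' t → u ≢ u' → u ∉ W → u' ∉ W → Opposite t u u'
  missing-opposite {t} {u} {u'} ter ter' u≢u' u∉ u'∉ = finish (not-kept ter u∉) (not-kept ter' u'∉) (proj₂ (omitted t))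
    where
    finish : u ≡ e₁ t ⊎ u ≡ e₂ t → u' ≡ e₁ t ⊎ u' ≡ e₂ t →
             (t ∈ η × Terminal T (e₁ t) t × Terminal T (e₂ t) t × e₁ t ≢ e₂ t × Opposite t (e₁ t) (e₂ t)) ⊎ (t ∉ η × e₁ t ≡ e₂ t) →
             Opposite t u u'
    finish (inj₁ p) (inj₁ q) _ = contradiction (trans p (sym q)) u≢u'
    finish (inj₂ p) (inj₂ q) _ = contradiction (trans p (sym q)) u≢u'
    finish (inj₁ p) (inj₂ q) (inj₂ (_ , e≡)) = contradiction (trans p (trans e≡ (sym q))) u≢u'
    finish (inj₂ p) (inj₁ q) (inj₂ (_ , e≡)) = contradiction (trans p (trans (sym e≡) (sym q))) u≢u'
    finish (inj₁ p) (inj₂ q) (inj₁ (_ , _ , _ , _ , opp)) = subst₂ (Opposite t) (sym p) (sym q) opp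
    finish (inj₂ p) (inj₁ q) (inj₁ (_ , _ , _ , _ , opp)) = subst₂ (Opposite t) (sym p) (sym q) (opposite-sym opp)

  resolves : SResolving S W
  resolves = Separation.resolves S hasMajor W W-leaf two-legs⇒kept missing-opposite

  bound : Unique η → length W + (length exteriorMajors + length η) ≤ length ownedLeaves
  bound η-unique = begin
      length W + (length exteriorMajors + length η)
        ≤⟨ ℕₚ.+-monoʳ-≤ (length W) (ℕₚ.+-mono-≤ majors≤ special≤) ⟩
      length W + (length (filter first? ownedLeaves) + length (filter second? notFirst))
        ≡⟨ +-comm (length W) _ ⟩
      length (filter first? ownedLeaves) + length (filter second? notFirst) + length W
        ≡⟨ +-assoc (length (filter first? ownedLeaves)) _ _ ⟩
      length (filter first? ownedLeaves) + (length (filter second? notFirst) + length W)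
        ≡⟨ cong (length (filter first? ownedLeaves) +_) (sym (filter-split second? notFirst)) ⟩
      length (filter first? ownedLeaves) + length notFirst
        ≡⟨ sym (filter-split first? ownedLeaves) ⟩
      length ownedLeaves ∎
    where
    open ℕₚ.≤-Reasoning
    majors≤ : length exteriorMajors ≤ length (filter first? ownedLeaves)
    majors≤ = pigeonhole (λ t u → Terminal T u t) exteriorMajors _ exteriorMajors-unique
      (λ {t} t∈ → let ter = proj₁ (omitted t) (exteriorMajors⇒terminal t∈) in
                  e₁ t , ∈-filter⁺ first? (∈ownedLeaves ter) (t , ter , refl) , ter)
      (λ _ _ → terminal-owner)
    special≤ : length η ≤ length (filter second? notFirst)
    special≤ = pigeonhole (λ t u → Terminal T u t) η _ η-unique second-kept (λ _ _ → terminal-owner)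
      where
      second-kept : ∀ {t} → t ∈ η → ∃[ u ] u ∈ filter second? notFirst × Terminal T u t
      second-kept {t} t∈ with proj₂ (omitted t)
      ... | inj₂ (t∉ , _) = contradiction t∈ t∉
      -- As `e₁ t` and `e₂ t` differ, `e₂ t` survives the first stage and is counted in the second.
      ... | inj₁ (_ , _ , ter , e≢ , _) = e₂ t , ∈-filter⁺ second?
        (∈-filter⁺ (¬? ∘ first?) (∈ownedLeaves ter) λ { (t' , ter' , eq) → e≢ (sym (trans eq (cong e₁ (terminal-owner ter' ter)))) })
        (t , ter , refl) , ter

-- A minimum resolving set obeys the lower bound and is no larger than the constructed one. Apart
-- from `k` and `η`, the counts do not involve the signing, so two signings can be compared.
signed-dimension : {n : ℕ} {T : Tree n} (S : Signing T) → ∃ (Major T) →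
  (∀ t → Special S t → ¬ TerDeg T t 2) →
  (k : ℕ) (η : List (Fin n)) → IsSignedMetricDim S k → Unique η → (∀ t → (t ∈ η ⇔ Special S t)) →
  k + (length (Legs.exteriorMajors T) + length η) ≡ length (Legs.ownedLeaves T)
signed-dimension {n} {T} S hasMajor ter≢2 k η ((V , V-resolves , V-length) , minimal) η-unique η⇔special = ≤-antisym
    (≤-trans (ℕₚ.+-monoˡ-≤ _ (minimal W resolves)) (bound η-unique))
    (subst (λ l → length (Legs.ownedLeaves T) ≤ l + _) V-length
      (LowerBound.bound S V V-resolves η (λ t → Equivalence.from (η⇔special t))))
  where
  open UpperBound S hasMajor ter≢2 η η⇔special

-- The usual metric dimension through the all-positive signing.

module Unsigned {n : ℕ} (T : Tree n) where
  open Tree T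
  open TreeMetric T
  open Legs T

  allPlus : Signing T
  allPlus = record { σ = λ _ _ → Sign.+ ; σ-sym = λ _ _ → refl }

  open SignedMetric allPlus

  wsign-allPlus : ∀ {u w} (p : Walk E u w) → wsign (λ _ _ → Sign.+) p ≡ Sign.+
  wsign-allPlus (stop _)       = refl
  wsign-allPlus (step _ _ _ p) = wsign-allPlus p

  sdist≡d : ∀ u v → sdist allPlus u v ≡ Sign.+ ◃ d u v
  sdist≡d u v = cong (_◃ d u v) (wsign-allPlus (proj₁ (path u v)))

  signed⇔unsigned-resolving : ∀ W → SResolving allPlus W ⇔ Resolving T W
  signed⇔unsigned-resolving W = mk⇔
    (λ R u v eq → R u v (map-cong-local (All.tabulate λ {w} w∈ →
      trans (sdist≡d u w) (trans (cong (Sign.+ ◃_) (map-≡⇒pointwise eq w∈)) (sym (sdist≡d v w))))))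
    (λ R u v eq → R u v (map-cong-local (All.tabulate λ w∈ → sdist⇒d (map-≡⇒pointwise eq w∈))))

  -- Any two legs already agree at index 1. Hence the special list is empty here and the condition
  -- on terminal degrees holds vacuously.
  not-special : ∀ t → ¬ Special allPlus t
  not-special t (_ , u , u' , ter , ter' , _ , opp)
    with next-exists (terminal≢owner ter) | next-exists (terminal≢owner ter')
  ... | x , nx | y , ny = opp x y (btw⇒∈pathVerts (next⇒btw nx)) (btw⇒∈pathVerts (next⇒btw ny)) deq
      (≤-reflexive (sym (edge-d (proj₁ nx))))
      (trans (sdist≡d t x) (trans (cong (Sign.+ ◃_) deq) (sym (sdist≡d t y))))
    where
    deq = trans (edge-d (proj₁ nx)) (sym (edge-d (proj₁ ny)))

  unsigned-dimension : ∃ (Major T) → (k : ℕ) → IsMetricDim T k → k + length exteriorMajors ≡ length ownedLeaves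
  unsigned-dimension hasMajor k ((V , V-resolves , V-length) , minimal) =
    trans (cong (_+_ k) (sym (ℕₚ.+-identityʳ _)))
      (signed-dimension allPlus hasMajor (λ t sp → contradiction sp (not-special t)) k []
        ((V , Equivalence.from (signed⇔unsigned-resolving V) V-resolves , V-length)
        , λ W R → minimal W (Equivalence.to (signed⇔unsigned-resolving W) R))
        [] (λ t → mk⇔ (λ ()) (λ sp → contradiction sp (not-special t))))

theorem4p3 : {n : ℕ} (T : Tree n) (S : Signing T) →
    ¬ IsPathGraph T →
    (∀ t → Special S t → ¬ TerDeg T t 2) →
    (k kσ : ℕ) (η : List (Fin n)) →
    IsMetricDim T k → IsSignedMetricDim S kσ →
    Unique η → (∀ t → (t ∈ η ⇔ Special S t)) →
    kσ + length η ≡ k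
theorem4p3 T S ¬path ter≢2 k kσ η dim dimσ η-unique η⇔special =
  -- Both dimensions are measured against the same number of terminal vertices, and the number of
  -- exterior major vertices cancels.
  ℕₚ.+-cancelʳ-≡ (length exteriorMajors) _ _ (begin
    kσ + length η + length exteriorMajors   ≡⟨ +-assoc kσ _ _ ⟩
    kσ + (length η + length exteriorMajors) ≡⟨ cong (_+_ kσ) (+-comm (length η) _) ⟩
    kσ + (length exteriorMajors + length η) ≡⟨ signed-dimension S hasMajor ter≢2 kσ η dimσ η-unique η⇔special ⟩
    length ownedLeaves                      ≡⟨ sym (Unsigned.unsigned-dimension T hasMajor k dim) ⟩
    k + length exteriorMajors               ∎)
  where
  open ≡-Reasoning
  open Legs T
  hasMajor = TreeShape.major-exists T ¬path
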